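{- If there exists a depth assignment $d:\Sigma^n\to\Sigma$ such that the valid subgraph of $B_n$ has a Hamiltonian cycle, then such a cycle $s_0,s_1,\dots,s_{N-1}$ (with $N=k^n$) corresponds to a de Bruijn sequence $s_0[0]s_1[0]\cdots s_{N-1}[0]$ of order $n$ whose discrepancy is at most $n+1$.
   Context: Let $k\ge 1$ be an integer, $\Sigma=\{0,1,\dots,k-1\}$ with arithmetic on symbols taken modulo $k$, and $n\ge 1$. For $s\in\Sigma^n$ write $s=s[0]\cdots s[n-1]$. The de Bruijn graph $B_n$ has node set $\Sigma^n$ and an arc $(s,t)$ iff $s[1]\cdots s[n-1]=t[0]\cdots t[n-2]$. A depth assignment is any function $d:\Sigma^n\to\Sigma$, written $s\mapsto d_s$. An arc $(s,t)$ of $B_n$ is valid (with respect to $d$) if, with $b=s[0]$ and $c=t[n-1]$, either ($b+1=c$ and $d_s=d_t$) or ($b+1=d_t$ and $c=d_s$); the valid arcs (on all of $\Sigma^n$) form the valid subgraph. A de Bruijn sequence of order $n$ is a circular string of length $k^n$ in which every string in $\Sigma^n$ occurs exactly once. The discrepancy of a string $w$ is the maximum over all substrings $s$ of $w$ (viewed circularly) of $\max_{a\in\Sigma}|s|_a-\min_{c\in\Sigma}|s|_c$, where $|s|_a$ is the number of occurrences of $a$ in $s$. -}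

module Defs where

open import Data.Nat using (ℕ; suc; _+_; _∸_; _^_)
open import Data.Nat.DivMod using (_mod_)
open import Data.Fin using (Fin; toℕ; _≟_)
open import Data.Fin.Properties using (nonZeroIndex)
open import Data.List as List using (List; allFin; upTo; cartesianProductWith)
open import Data.List.Extrema.Nat using (max; min)
open import Data.Product using (_×_; ∃!)
open import Data.Sum using (_⊎_)
open import Data.Vec using (Vec; head; tail; init; last; tabulate; count)
open import Function using (Bijective)
open import Level using (0ℓ)
open import Relation.Binary using (Rel)
open import Relation.Binary.PropositionalEquality using (_≡_)

-- Addition modulo N, used both for symbols (N = k) and for circular positions.
infixl 6 _⊕_
_⊕_ : ∀ {N} → Fin N → ℕ → Fin N
_⊕_ {N} i j = ((toℕ i + j) mod N) {{nonZeroIndex i}}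

Word : ℕ → ℕ → Set
Word k n = Vec (Fin k) n

Arc : ∀ {k m} → Rel (Word k (suc m)) 0ℓ
Arc s t = tail s ≡ init t

DepthAssignment : ℕ → ℕ → Set
DepthAssignment k n = Word k n → Fin k

ValidArc : ∀ {k m} → DepthAssignment k (suc m) → Rel (Word k (suc m)) 0ℓ
ValidArc d s t = Arc s t × ((b ⊕ 1 ≡ c × d s ≡ d t) ⊎ (b ⊕ 1 ≡ d t × c ≡ d s))
  where
  b = head s
  c = last t

-- For N = 1 this asks for a loop, and for N = 2 for a pair of opposite arcs.
IsHamiltonianCycle : {A : Set} → Rel A 0ℓ → ∀ {N} → (Fin N → A) → Set
IsHamiltonianCycle _⟶_ s = Bijective _≡_ _≡_ s × (∀ i → s i ⟶ s (i ⊕ 1))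

CircularString : ℕ → ℕ → Set
CircularString k N = Fin N → Fin k

-- The length l may exceed N, in which case the substring wraps around; this
-- occurs in IsDeBruijn only for k = 1.
substring : ∀ {k N} → CircularString k N → Fin N → (l : ℕ) → Word k l
substring w i l = tabulate (λ j → w (i ⊕ toℕ j))

IsDeBruijn : ∀ {k} n → CircularString k (k ^ n) → Set
IsDeBruijn {k} n w = (u : Word k n) → ∃! _≡_ (λ i → substring w i n ≡ u)

occurrences : ∀ {k l} → Word k l → Fin k → ℕ
occurrences s a = count (a ≟_) s

-- Every count lies between 0 and l, so for k ≥ 1 the default values 0 and l
-- do not affect the maximum and the minimum.
spread : ∀ {k l} → Word k l → ℕ
spread {k} {l} s = max 0 counts ∸ min l counts
  where
  counts : List ℕ
  counts = List.map (occurrences s) (allFin k)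

-- Substrings of a circular string of length N have length at most N.
discrepancy : ∀ {k N} → CircularString k N → ℕ
discrepancy {N = N} w =
  max 0 (cartesianProductWith (λ i l → spread (substring w i l)) (allFin N) (upTo (suc N)))

{-# OPTIONS --safe #-}

-- Validity of an arc (s, t) says that {d_t, t[n-1]} = {s[0]+1, d_s} as multisets,
-- so the multisets of the n+1 symbols of d_s s and d_t t are related by
-- {s[0]+1} + d_s s = {s[0]} + d_t t.  Along a walk from s to t that spells the
-- word u this adds up to (u+1) + d_s s = u + d_t t, where u+1 is u with every
-- symbol increased by 1.  For a ≤ b, the symbols of u+1 in (a, b] come from those
-- of u in [a, b), so counting the symbols in (a, b] on both sides expresses
-- |u|_a - |u|_b as the difference of two numbers between 0 and n+1.
module Submission where

open import Defs
open import Data.Bool using (true; false)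
open import Data.Fin as Fin using (Fin; toℕ; _≟_)
open import Data.Fin.Properties as Fin using (nonZeroIndex; toℕ-fromℕ<; toℕ-injective; toℕ<n)
open import Data.List using (List; []; _∷_; _++_; [_]; map; filter; length; allFin; upTo)
open import Data.List.Extrema.Nat using (max; min; max≤v⁺; v≤min⁺)
open import Data.List.Properties using (filter-++; filter-≐; length-filter; length-++)
open import Data.List.Relation.Binary.Permutation.Propositional
  using (_↭_; ↭-refl; ↭-prep; ↭-swap; ↭-trans; module PermutationReasoning)
open import Data.List.Relation.Binary.Permutation.Propositional.Properties
  using (↭-length; filter-↭; shift; ++⁺ˡ; ++⁺ʳ)
import Data.List.Relation.Unary.All.Properties as All
open import Data.Nat
  using (ℕ; zero; suc; _+_; _∸_; _⊔_; _^_; _≤_; _<_; ∣_-_∣; z≤n; s≤s; s≤s⁻¹; NonZero)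
open import Data.Nat.DivMod
  using (_%_; m%n<n; m%n%n≡m%n; n%n≡0; m<n⇒m%n≡m; %-distribˡ-+)
open import Data.Nat.Properties hiding (_≟_)
open import Algebra.Properties.CommutativeSemigroup +-commutativeSemigroup
  using (x∙yz≈y∙xz; xy∙z≈y∙xz)
open import Data.Product using (_×_; _,_; proj₁)
open import Data.Sum using (_⊎_; inj₁; inj₂)
open import Data.Vec as Vec using (Vec; []; _∷_; head; tail; init; last; tabulate; toList)
open import Data.Vec.Properties using (count≤n; length-toList; tabulate-cong)
open import Function using (Bijective; _∘_)
open import Level using (Level; 0ℓ)
open import Relation.Binary using (Rel)
open import Relation.Binary.Consequences using (wlog)
open import Relation.Binary.PropositionalEquality
  using (_≡_; refl; sym; trans; cong; cong₂; subst; setoid; module ≡-Reasoning)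
open import Relation.Nullary using (yes; no; does; contradiction)
open import Relation.Unary using (Pred; Decidable; _∩_; _∪_; _⊆_; _≐_; _⊥_; _⊢_; ｛_｝)
open import Relation.Unary.Properties using (_∩?_; _∪?_)

private
  variable
    ℓ ℓ₁ ℓ₂ : Level
    A B : Set ℓ
    P : Pred A ℓ₁
    Q : Pred A ℓ₂
    k l m N : ℕ

[m%n+o]%n≡[m+o]%n : ∀ m n o .{{_ : NonZero n}} → (m % n + o) % n ≡ (m + o) % n
[m%n+o]%n≡[m+o]%n m n o = begin
  (m % n + o) % n           ≡⟨ %-distribˡ-+ (m % n) o n ⟩
  (m % n % n + o % n) % n   ≡⟨ cong (λ x → (x + o % n) % n) (m%n%n≡m%n m n) ⟩
  (m % n + o % n) % n       ≡⟨ %-distribˡ-+ m o n ⟨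
  (m + o) % n               ∎
  where open ≡-Reasoning

m+o≡n+p⇒∣m-n∣≤o⊔p : ∀ m n {o p} → m + o ≡ n + p → ∣ m - n ∣ ≤ o ⊔ p
m+o≡n+p⇒∣m-n∣≤o⊔p m n {o} {p} m+o≡n+p = begin
  ∣ m - n ∣           ≡⟨ ∣-∣-comm m n ⟩
  ∣ n - m ∣           ≡⟨ ∣m+n-m+o∣≡∣n-o∣ p n m ⟨
  ∣ p + n - p + m ∣   ≡⟨ cong₂ ∣_-_∣ (trans (+-comm p n) (sym m+o≡n+p)) (+-comm p m) ⟩
  ∣ m + o - m + p ∣   ≡⟨ ∣m+n-m+o∣≡∣n-o∣ m o p ⟩
  ∣ o - p ∣           ≤⟨ ∣m-n∣≤m⊔n o p ⟩
  o ⊔ p               ∎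
  where open ≤-Reasoning

toℕ-⊕ : (i : Fin N) (j : ℕ) → toℕ (i ⊕ j) ≡ ((toℕ i + j) % N) {{nonZeroIndex i}}
toℕ-⊕ {N} i j = toℕ-fromℕ< (m%n<n (toℕ i + j) N {{nonZeroIndex i}})

i+j<N⇒toℕ[i⊕j]≡i+j : (i : Fin N) {j : ℕ} → toℕ i + j < N → toℕ (i ⊕ j) ≡ toℕ i + j
i+j<N⇒toℕ[i⊕j]≡i+j i i+j<N = trans (toℕ-⊕ i _) (m<n⇒m%n≡m {{nonZeroIndex i}} i+j<N)

i+j≡N⇒toℕ[i⊕j]≡0 : (i : Fin N) {j : ℕ} → toℕ i + j ≡ N → toℕ (i ⊕ j) ≡ 0
i+j≡N⇒toℕ[i⊕j]≡0 {N = N@(suc _)} i i+j≡N =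
  trans (toℕ-⊕ i _) (trans (cong (_% N) i+j≡N) (n%n≡0 N))

toℕ-⊕1 : (i : Fin N) → toℕ (i ⊕ 1) ≡ suc (toℕ i) ⊎ (suc (toℕ i) ≡ N × toℕ (i ⊕ 1) ≡ 0)
toℕ-⊕1 {N} i with i+1≡1+i ← +-comm (toℕ i) 1 | m≤n⇒m<n∨m≡n (toℕ<n i)
... | inj₁ 1+i<N = inj₁ (trans (i+j<N⇒toℕ[i⊕j]≡i+j i (subst (_< N) (sym i+1≡1+i) 1+i<N)) i+1≡1+i)
... | inj₂ 1+i≡N = inj₂ (1+i≡N , i+j≡N⇒toℕ[i⊕j]≡0 i (trans i+1≡1+i 1+i≡N))

⊕-identityʳ : (i : Fin N) → i ⊕ 0 ≡ i
⊕-identityʳ {N} i =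
  toℕ-injective (trans (i+j<N⇒toℕ[i⊕j]≡i+j i (subst (_< N) (sym i+0≡i) (toℕ<n i))) i+0≡i)
  where
  i+0≡i : toℕ i + 0 ≡ toℕ i
  i+0≡i = +-identityʳ (toℕ i)

⊕-assoc : (i : Fin N) (p q : ℕ) → i ⊕ p ⊕ q ≡ i ⊕ (p + q)
⊕-assoc {N = N@(suc _)} i p q = toℕ-injective (begin
  toℕ (i ⊕ p ⊕ q)             ≡⟨ toℕ-⊕ (i ⊕ p) q ⟩
  (toℕ (i ⊕ p) + q) % N       ≡⟨ cong (λ x → (x + q) % N) (toℕ-⊕ i p) ⟩
  ((toℕ i + p) % N + q) % N   ≡⟨ [m%n+o]%n≡[m+o]%n (toℕ i + p) N q ⟩
  (toℕ i + p + q) % N         ≡⟨ cong (_% N) (+-assoc (toℕ i) p q) ⟩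
  (toℕ i + (p + q)) % N       ≡⟨ toℕ-⊕ i (p + q) ⟨
  toℕ (i ⊕ (p + q))           ∎)
  where open ≡-Reasoning

count : {P : Pred A ℓ} → Decidable P → List A → ℕ
count P? xs = length (filter P? xs)

count-++ : (P? : Decidable P) (xs ys : List A) → count P? (xs ++ ys) ≡ count P? xs + count P? ys
count-++ P? xs ys = trans (cong length (filter-++ P? xs ys)) (length-++ (filter P? xs))

count-↭ : (P? : Decidable P) {xs ys : List A} → xs ↭ ys → count P? xs ≡ count P? ys
count-↭ P? xs↭ys = ↭-length (filter-↭ P? xs↭ys)

count-≐ : (P? : Decidable P) (Q? : Decidable Q) → P ≐ Q → (xs : List A) →
  count P? xs ≡ count Q? xs
count-≐ P? Q? P≐Q xs = cong length (filter-≐ P? Q? P≐Q xs)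

count-map : (P? : Decidable P) (f : B → A) (xs : List B) →
  count P? (map f xs) ≡ count (P? ∘ f) xs
count-map P? f []       = refl
count-map P? f (x ∷ xs) with does (P? (f x))
... | true  = cong suc (count-map P? f xs)
... | false = count-map P? f xs

count-∪ : (P? : Decidable P) (Q? : Decidable Q) → P ⊥ Q → (xs : List A) →
  count (P? ∪? Q?) xs ≡ count P? xs + count Q? xs
count-∪ P? Q? P⊥Q []       = refl
count-∪ P? Q? P⊥Q (x ∷ xs) with P? x | Q? x
... | yes Px | yes Qx = contradiction (Px , Qx) P⊥Q
... | yes _  | no _   = cong suc (count-∪ P? Q? P⊥Q xs)
... | no _   | yes _  = trans (cong suc (count-∪ P? Q? P⊥Q xs)) (sym (+-suc _ _))
... | no _   | no _   = count-∪ P? Q? P⊥Q xs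

count-toList : (P? : Decidable P) (u : Vec A l) → count P? (toList u) ≡ Vec.count P? u
count-toList P? []      = refl
count-toList P? (x ∷ u) with does (P? x)
... | true  = cong suc (count-toList P? u)
... | false = count-toList P? u

Closed LeftOpen RightOpen : Fin k → Fin k → Pred (Fin k) 0ℓ
Closed    a b = (a Fin.≤_) ∩ (Fin._≤ b)
LeftOpen  a b = (a Fin.<_) ∩ (Fin._≤ b)
RightOpen a b = (a Fin.≤_) ∩ (Fin._< b)

closed? : (a b : Fin k) → Decidable (Closed a b)
closed? a b = (a Fin.≤?_) ∩? (Fin._≤? b)

leftOpen? : (a b : Fin k) → Decidable (LeftOpen a b)
leftOpen? a b = (a Fin.<?_) ∩? (Fin._≤? b)

rightOpen? : (a b : Fin k) → Decidable (RightOpen a b)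
rightOpen? a b = (a Fin.≤?_) ∩? (Fin._<? b)

-- The wrap-around from k - 1 to 0 does no harm: k - 1 is not in [a, b), 0 not in (a, b].
⊕1⊢LeftOpen≐RightOpen : (a b : Fin k) → (_⊕ 1) ⊢ LeftOpen a b ≐ RightOpen a b
⊕1⊢LeftOpen≐RightOpen a b = to , from
  where
  to : (_⊕ 1) ⊢ LeftOpen a b ⊆ RightOpen a b
  to {x} (a<x+1 , x+1≤b) with toℕ (x ⊕ 1) | toℕ-⊕1 x
  ... | _ | inj₁ refl       = s≤s⁻¹ a<x+1 , x+1≤b
  ... | _ | inj₂ (_ , refl) = contradiction a<x+1 n≮0

  from : RightOpen a b ⊆ (_⊕ 1) ⊢ LeftOpen a b
  from {x} (a≤x , x<b) with toℕ (x ⊕ 1) | toℕ-⊕1 x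
  ... | _ | inj₁ refl        = s≤s a≤x , x<b
  ... | _ | inj₂ (1+x≡k , _) =
    contradiction (toℕ<n b) (≤⇒≯ (≤-trans (≤-reflexive (sym 1+x≡k)) x<b))

｛｝∪LeftOpen≐Closed : {a b : Fin k} → a Fin.≤ b → ｛ a ｝ ∪ LeftOpen a b ≐ Closed a b
｛｝∪LeftOpen≐Closed {a = a} {b} a≤b = to , from
  where
  to : ｛ a ｝ ∪ LeftOpen a b ⊆ Closed a b
  to (inj₁ refl)        = Fin.≤-refl , a≤b
  to (inj₂ (a<x , x≤b)) = <⇒≤ a<x , x≤b

  from : Closed a b ⊆ ｛ a ｝ ∪ LeftOpen a b
  from {x} (a≤x , x≤b) with a ≟ x
  ... | yes a≡x = inj₁ a≡x
  ... | no a≢x  = inj₂ (Fin.≤∧≢⇒< a≤x a≢x , x≤b)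

｛｝∪RightOpen≐Closed : {a b : Fin k} → a Fin.≤ b → ｛ b ｝ ∪ RightOpen a b ≐ Closed a b
｛｝∪RightOpen≐Closed {a = a} {b} a≤b = to , from
  where
  to : ｛ b ｝ ∪ RightOpen a b ⊆ Closed a b
  to (inj₁ refl)        = a≤b , Fin.≤-refl
  to (inj₂ (a≤x , x<b)) = a≤x , <⇒≤ x<b

  from : Closed a b ⊆ ｛ b ｝ ∪ RightOpen a b
  from {x} (a≤x , x≤b) with b ≟ x
  ... | yes b≡x = inj₁ b≡x
  ... | no b≢x  = inj₂ (a≤x , Fin.≤∧≢⇒< x≤b (b≢x ∘ sym))

count-LeftOpen-RightOpen : {a b : Fin k} → a Fin.≤ b → (xs : List (Fin k)) →
  count (a ≟_) xs + count (leftOpen? a b) xs ≡ count (b ≟_) xs + count (rightOpen? a b) xs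
count-LeftOpen-RightOpen {a = a} {b} a≤b xs = begin
  count (a ≟_) xs + count (leftOpen? a b) xs
    ≡⟨ count-∪ (a ≟_) (leftOpen? a b) a∉LeftOpen xs ⟨
  count ((a ≟_) ∪? leftOpen? a b) xs
    ≡⟨ count-≐ _ (closed? a b) (｛｝∪LeftOpen≐Closed a≤b) xs ⟩
  count (closed? a b) xs
    ≡⟨ count-≐ _ (closed? a b) (｛｝∪RightOpen≐Closed a≤b) xs ⟨
  count ((b ≟_) ∪? rightOpen? a b) xs
    ≡⟨ count-∪ (b ≟_) (rightOpen? a b) b∉RightOpen xs ⟩
  count (b ≟_) xs + count (rightOpen? a b) xs
    ∎
  where
  open ≡-Reasoning
  a∉LeftOpen : ｛ a ｝ ⊥ LeftOpen a b
  a∉LeftOpen (refl , a<a , _) = n≮n _ a<a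

  b∉RightOpen : ｛ b ｝ ⊥ RightOpen a b
  b∉RightOpen (refl , _ , b<b) = n≮n _ b<b

Exchange : List (Fin k) → Rel (List (Fin k)) 0ℓ
Exchange xs ys zs = map (_⊕ 1) xs ++ ys ↭ xs ++ zs

exchange-∷ : ∀ (x : Fin k) xs {ws ys zs} →
  Exchange [ x ] ws ys → Exchange xs ys zs → Exchange (x ∷ xs) ws zs
exchange-∷ x xs {ws} {ys} {zs} ws⇝ys ys⇝zs = begin
  x ⊕ 1 ∷ map (_⊕ 1) xs ++ ws        ↭⟨ shift (x ⊕ 1) (map (_⊕ 1) xs) ws ⟨
  map (_⊕ 1) xs ++ [ x ⊕ 1 ] ++ ws   ↭⟨ ++⁺ˡ (map (_⊕ 1) xs) ws⇝ys ⟩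
  map (_⊕ 1) xs ++ [ x ] ++ ys       ↭⟨ shift x (map (_⊕ 1) xs) ys ⟩
  x ∷ map (_⊕ 1) xs ++ ys            ↭⟨ ↭-prep x ys⇝zs ⟩
  x ∷ xs ++ zs                       ∎
  where open PermutationReasoning

exchange-count : ∀ (P? : Decidable P) (xs : List (Fin k)) {ys zs} → Exchange xs ys zs →
  count (P? ∘ (_⊕ 1)) xs + count P? ys ≡ count P? xs + count P? zs
exchange-count P? xs {ys} {zs} ys⇝zs = begin
  count (P? ∘ (_⊕ 1)) xs + count P? ys     ≡⟨ cong (_+ count P? ys) (count-map P? (_⊕ 1) xs) ⟨
  count P? (map (_⊕ 1) xs) + count P? ys   ≡⟨ count-++ P? (map (_⊕ 1) xs) ys ⟨
  count P? (map (_⊕ 1) xs ++ ys)           ≡⟨ count-↭ P? ys⇝zs ⟩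
  count P? (xs ++ zs)                      ≡⟨ count-++ P? xs zs ⟩
  count P? xs + count P? zs                ∎
  where open ≡-Reasoning

exchange-difference : ∀ (xs : List (Fin k)) {ys zs} → Exchange xs ys zs →
  {a b : Fin k} → a Fin.≤ b →
  count (a ≟_) xs + count (leftOpen? a b) ys ≡ count (b ≟_) xs + count (leftOpen? a b) zs
exchange-difference xs {ys} {zs} ys⇝zs {a} {b} a≤b = sym (+-cancelˡ-≡ (#⟨a,b] xs) _ _ (begin
  #⟨a,b] xs + (#b + #⟨a,b] zs)   ≡⟨ x∙yz≈y∙xz (#⟨a,b] xs) #b (#⟨a,b] zs) ⟩
  #b + (#⟨a,b] xs + #⟨a,b] zs)   ≡⟨ cong (#b +_) (exchange-count (leftOpen? a b) xs ys⇝zs) ⟨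
  #b + (#⟨a,b]∘⊕1 + #⟨a,b] ys)   ≡⟨ cong (λ c → #b + (c + #⟨a,b] ys)) #⟨a,b]∘⊕1≡#[a,b⟩ ⟩
  #b + (#[a,b⟩ + #⟨a,b] ys)      ≡⟨ +-assoc #b #[a,b⟩ (#⟨a,b] ys) ⟨
  #b + #[a,b⟩ + #⟨a,b] ys        ≡⟨ cong (_+ #⟨a,b] ys) (count-LeftOpen-RightOpen a≤b xs) ⟨
  #a + #⟨a,b] xs + #⟨a,b] ys     ≡⟨ xy∙z≈y∙xz #a (#⟨a,b] xs) (#⟨a,b] ys) ⟩
  #⟨a,b] xs + (#a + #⟨a,b] ys)   ∎))
  where
  open ≡-Reasoning
  #a #b #[a,b⟩ #⟨a,b]∘⊕1 : ℕ
  #a        = count (a ≟_) xs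
  #b        = count (b ≟_) xs
  #[a,b⟩    = count (rightOpen? a b) xs
  #⟨a,b]∘⊕1 = count (leftOpen? a b ∘ (_⊕ 1)) xs

  #⟨a,b] : List (Fin _) → ℕ
  #⟨a,b] = count (leftOpen? a b)

  #⟨a,b]∘⊕1≡#[a,b⟩ : #⟨a,b]∘⊕1 ≡ #[a,b⟩
  #⟨a,b]∘⊕1≡#[a,b⟩ = count-≐ _ (rightOpen? a b) (⊕1⊢LeftOpen≐RightOpen a b) xs

exchange-balanced : ∀ (xs : List (Fin k)) {ys zs} → Exchange xs ys zs → (a b : Fin k) →
  ∣ count (a ≟_) xs - count (b ≟_) xs ∣ ≤ length ys ⊔ length zs
exchange-balanced xs {ys} {zs} ys⇝zs = wlog Fin.≤-total
  (λ {a} {b} → ≤-trans (≤-reflexive (∣-∣-comm (count (b ≟_) xs) (count (a ≟_) xs))))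
  λ a b a≤b → ≤-trans
    (m+o≡n+p⇒∣m-n∣≤o⊔p (count (a ≟_) xs) (count (b ≟_) xs) (exchange-difference xs ys⇝zs a≤b))
    (⊔-mono-≤ (length-filter (leftOpen? a b) ys) (length-filter (leftOpen? a b) zs))

head∷tail : (u : Vec A (suc m)) → head u ∷ tail u ≡ u
head∷tail (_ ∷ _) = refl

head-init : (u : Vec A (suc (suc m))) → head (init u) ≡ head u
head-init (_ ∷ _ ∷ _) = refl

tail-init : (u : Vec A (suc (suc m))) → tail (init u) ≡ init (tail u)
tail-init (_ ∷ _ ∷ _) = refl

last∷init↭ : (u : Vec A (suc m)) → last u ∷ toList (init u) ↭ toList u
last∷init↭ (x ∷ [])        = ↭-refl
last∷init↭ (x ∷ u@(_ ∷ _)) = ↭-trans (↭-swap (last u) x ↭-refl) (↭-prep x (last∷init↭ u))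

Walk : {A : Set} → Rel A 0ℓ → (ℕ → A) → Set
Walk _⟶_ S = ∀ j → S j ⟶ S (suc j)

cycle⇒walk : {A : Set} (_⟶_ : Rel A 0ℓ) {s : Fin N → A} →
  (∀ i → s i ⟶ s (i ⊕ 1)) → ∀ i → Walk _⟶_ (λ j → s (i ⊕ j))
cycle⇒walk _⟶_ {s} cycle i j =
  subst (λ i′ → s (i ⊕ j) ⟶ s i′) (trans (⊕-assoc i j 1) (cong (i ⊕_) (+-comm j 1))) (cycle (i ⊕ j))

spell : (ℕ → Word k (suc m)) → (l : ℕ) → Word k l
spell S l = tabulate (λ j → head (S (toℕ j)))

init-walk : (S : ℕ → Word k (suc (suc m))) → Walk Arc S → Walk Arc (init ∘ S)
init-walk S walk j = trans (tail-init (S j)) (cong init (walk j))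

spell-walk : (S : ℕ → Word k (suc m)) → Walk Arc S → spell S (suc m) ≡ S 0
spell-walk {m = zero} S walk with S 0
... | _ ∷ [] = refl
spell-walk {m = suc m} S walk = begin
  head (S 0) ∷ spell (S ∘ suc) (suc m)
    ≡⟨ cong (head (S 0) ∷_) (tabulate-cong (head-init ∘ S ∘ suc ∘ toℕ)) ⟨
  head (S 0) ∷ spell (init ∘ S ∘ suc) (suc m)
    ≡⟨ cong (head (S 0) ∷_) (spell-walk (init ∘ S ∘ suc) (init-walk (S ∘ suc) (walk ∘ suc))) ⟩
  head (S 0) ∷ init (S 1)
    ≡⟨ cong (head (S 0) ∷_) (walk 0) ⟨
  head (S 0) ∷ tail (S 0)
    ≡⟨ head∷tail (S 0) ⟩
  S 0
    ∎
  where open ≡-Reasoning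

module _ (d : DepthAssignment k (suc m)) where

  content : Word k (suc m) → List (Fin k)
  content s = d s ∷ toList s

  length-content : ∀ s → length (content s) ≡ suc (suc m)
  length-content s = cong suc (length-toList s)

  validArc⇒↭ : ∀ {s t} → ValidArc d s t → head s ⊕ 1 ∷ d s ∷ [] ↭ d t ∷ last t ∷ []
  validArc⇒↭ (_ , inj₁ (b+1≡c , ds≡dt)) rewrite b+1≡c | ds≡dt = ↭-swap _ _ ↭-refl
  validArc⇒↭ (_ , inj₂ (b+1≡dt , c≡ds)) rewrite b+1≡dt | c≡ds = ↭-refl

  validArc⇒exchange : ∀ {s t} → ValidArc d s t → Exchange [ head s ] (content s) (content t)
  validArc⇒exchange {s@(x ∷ u)} {t} valid@(u≡init[t] , _) = begin
    x ⊕ 1 ∷ d s ∷ x ∷ toList u           ↭⟨ shift x (x ⊕ 1 ∷ d s ∷ []) (toList u) ⟩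
    x ∷ x ⊕ 1 ∷ d s ∷ toList u           ≡⟨ cong (λ v → x ∷ x ⊕ 1 ∷ d s ∷ toList v) u≡init[t] ⟩
    x ∷ x ⊕ 1 ∷ d s ∷ toList (init t)    ↭⟨ ↭-prep x (++⁺ʳ (toList (init t)) (validArc⇒↭ valid)) ⟩
    x ∷ d t ∷ last t ∷ toList (init t)   ↭⟨ ↭-prep x (↭-prep (d t) (last∷init↭ t)) ⟩
    x ∷ d t ∷ toList t                   ∎
    where open PermutationReasoning

  walk⇒exchange : (S : ℕ → Word k (suc m)) → Walk (ValidArc d) S → ∀ l →
    Exchange (toList (spell S l)) (content (S 0)) (content (S l))
  walk⇒exchange S walk zero    = ↭-refl
  walk⇒exchange S walk (suc l) =
    exchange-∷ _ _ (validArc⇒exchange (walk 0)) (walk⇒exchange (S ∘ suc) (walk ∘ suc) l)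

  spell-balanced : (S : ℕ → Word k (suc m)) → Walk (ValidArc d) S → ∀ l a b →
    ∣ occurrences (spell S l) a - occurrences (spell S l) b ∣ ≤ suc (suc m)
  spell-balanced S walk l a b = begin
    ∣ occurrences u a - occurrences u b ∣
      ≡⟨ cong₂ ∣_-_∣ (count-toList (a ≟_) u) (count-toList (b ≟_) u) ⟨
    ∣ count (a ≟_) (toList u) - count (b ≟_) (toList u) ∣
      ≤⟨ exchange-balanced (toList u) (walk⇒exchange S walk l) a b ⟩
    length (content (S 0)) ⊔ length (content (S l))
      ≡⟨ cong₂ _⊔_ (length-content (S 0)) (length-content (S l)) ⟩
    suc (suc m) ⊔ suc (suc m)
      ≡⟨ ⊔-idem (suc (suc m)) ⟩
    suc (suc m)
      ∎
    where
    open ≤-Reasoning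
    u : Word k l
    u = spell S l

max∸min≤ : (f : Fin k → ℕ) {b c : ℕ} → (∀ i → f i ≤ b) → (∀ i j → ∣ f i - f j ∣ ≤ c) →
  max 0 (map f (allFin k)) ∸ min b (map f (allFin k)) ≤ c
max∸min≤ {k} f {b} {c} f≤b ∣f-f∣≤c = m≤n+o⇒m∸n≤o _ (min b values)
  (max≤v⁺ z≤n (All.map⁺ (All.tabulate⁺ f≤min+c)))
  where
  open ≤-Reasoning
  values : List ℕ
  values = map f (allFin k)

  f∸c≤f : ∀ i j → f i ∸ c ≤ f j
  f∸c≤f i j = m≤n+o⇒m∸n≤o (f i) c (begin
    f i                   ≤⟨ m≤∣m-n∣+n (f i) (f j) ⟩
    ∣ f i - f j ∣ + f j   ≤⟨ +-monoˡ-≤ (f j) (∣f-f∣≤c i j) ⟩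
    c + f j               ∎)

  f∸c≤min : ∀ i → f i ∸ c ≤ min b values
  f∸c≤min i = v≤min⁺ (≤-trans (m∸n≤m (f i) c) (f≤b i)) (All.map⁺ (All.tabulate⁺ (f∸c≤f i)))

  f≤min+c : ∀ i → f i ≤ min b values + c
  f≤min+c i = begin
    f i                ≤⟨ m≤n+m∸n (f i) c ⟩
    c + (f i ∸ c)      ≤⟨ +-monoʳ-≤ c (f∸c≤min i) ⟩
    c + min b values   ≡⟨ +-comm c (min b values) ⟩
    min b values + c   ∎

spread≤ : (u : Word k l) {c : ℕ} → (∀ a b → ∣ occurrences u a - occurrences u b ∣ ≤ c) →
  spread u ≤ c
spread≤ u = max∸min≤ (occurrences u) (λ a → count≤n (a ≟_) u)

discrepancy≤ : (w : CircularString k N) {c : ℕ} → (∀ i l → spread (substring w i l) ≤ c) →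
  discrepancy w ≤ c
discrepancy≤ {N = N} w spread≤c = max≤v⁺ z≤n
  (All.cartesianProductWith⁺ (setoid _) (setoid _) _ (allFin N) (upTo (suc N)) λ _ _ → spread≤c _ _)

bijection⇒deBruijn : {s : Fin (k ^ l) → Word k l} (w : CircularString k (k ^ l)) →
  Bijective _≡_ _≡_ s → (∀ i → substring w i l ≡ s i) → IsDeBruijn l w
bijection⇒deBruijn w (injective , surjective) substring≡s u with surjective u
... | i , s[i]≡u = i , trans (substring≡s i) (s[i]≡u refl) ,
  λ {j} sub≡u → injective (trans (s[i]≡u refl) (trans (sym sub≡u) (substring≡s j)))

theorem2 : (k m : ℕ) → 1 ≤ k →
    let n = suc m in
    (d : DepthAssignment k n) (s : Fin (k ^ n) → Word k n) →
    IsHamiltonianCycle (ValidArc d) s →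
    let w : CircularString k (k ^ n)
        w = λ i → head (s i)
    in IsDeBruijn n w × discrepancy w ≤ n + 1
theorem2 k m _ d s (bijective , cycle) =
  bijection⇒deBruijn w bijective substring≡s , discrepancy≤ w spread≤n+1
  where
  n : ℕ
  n = suc m

  w : CircularString k (k ^ n)
  w i = head (s i)

  nodesFrom : Fin (k ^ n) → ℕ → Word k n
  nodesFrom i j = s (i ⊕ j)

  walk : ∀ i → Walk (ValidArc d) (nodesFrom i)
  walk = cycle⇒walk (ValidArc d) cycle

  substring≡s : ∀ i → substring w i n ≡ s i
  substring≡s i = trans (spell-walk (nodesFrom i) (proj₁ ∘ walk i)) (cong s (⊕-identityʳ i))

  spread≤n+1 : ∀ i l → spread (substring w i l) ≤ n + 1
  spread≤n+1 i l = subst (spread (substring w i l) ≤_) (+-comm 1 n)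
    (spread≤ (substring w i l) (spell-balanced d (nodesFrom i) (walk i) l))
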